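{- Let $B$ be a complete Boolean algebra, let $X$ and $Y$ be CFG-spaces over $B$, let $U\subset X$ and $V\subset Y$ be arbitrary nonempty subsets, and let $f:U\to V$ be a contractive map. Then there is a unique contractive map $\mathrm{Conv}(f):\mathrm{Conv}(U)\to\mathrm{Conv}(V)$ extending $f$. Moreover, if $f$ is an isometry, then $\mathrm{Conv}(f)$ is an isometry.
   Context: A Boolean metric space over $B$ is a set with symmetric $d$ into $B$, $d(x,y)=0$ iff $x=y$, $d(x,z)\le d(x,y)\vee d(y,z)$. Contractive: $d(f(x),f(y))\le d(x,y)$; isometry: bijection preserving $d$. A partition of $B$ is a finite family of pairwise disjoint elements with supremum $1$; $x$ is a convex combination of $x_0,\dots,x_n$ with coefficients a partition $a_0,\dots,a_n$ if $a_i\wedge d(x,x_i)=0$ for all $i$. A CFG-space is a Boolean metric space that is convex (every such convex combination of its points exists in it) and finitely generated (some finite subset $S$ has every point as a convex combination of points of $S$). For $U$ a subset of a CFG-space $X$ over a complete $B$, $\mathrm{Conv}(U)$ denotes the intersection of all subsets of $X$ containing $U$ that are CFG-spaces with the restricted metric; it is itself the least such CFG-subspace containing $U$. -}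

module Defs where

open import Level using (Level; _⊔_; suc)
open import Algebra.Lattice.Bundles using (BooleanAlgebra)
import Algebra.Lattice.Properties.BooleanAlgebra as BooleanAlgebraProperties
open import Data.Fin.Base using (Fin)
open import Data.List.Base using (List)
import Data.List.Membership.Setoid as Membership
open import Data.Nat.Base using (ℕ) renaming (suc to 1+_)
open import Data.Product.Base using (Σ; ∃; _×_; _,_; proj₁)
open import Function.Base using (_on_)
open import Function.Bundles using (Func)
open import Function.Definitions using (Bijective)
open import Function.Metric.Structures using (IsGeneralMetric)
open import Relation.Binary.Bundles using (Setoid; Poset)
open import Relation.Binary.Core using (Rel)
import Relation.Binary.Construct.On as On
open import Relation.Binary.Definitions using (_Respects_)
open import Relation.Binary.PropositionalEquality.Core using (_≢_)
open import Relation.Unary using (Pred; _⊆_)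

module _ {b β : Level} (B : BooleanAlgebra b β) where

  open BooleanAlgebra B using (Carrier; _≈_; _∧_; ⊤; ⊥)
  private module BP = BooleanAlgebraProperties B

  -- The lattice order of B, i.e. x ≤ y is x ≈ x ∧ y.
  Order : Rel Carrier β
  Order = Poset._≤_ BP.poset

  IsSupremum : ∀ {i} {I : Set i} → (I → Carrier) → Carrier → Set (b ⊔ β ⊔ i)
  IsSupremum a s = (∀ i → Order (a i) s) × (∀ t → (∀ i → Order (a i) t) → Order s t)

  -- Suprema of families indexed by types in Set i.  These are all subsets of B
  -- when i = b = β.
  IsComplete : (i : Level) → Set (b ⊔ β ⊔ suc i)
  IsComplete i = {I : Set i} (a : I → Carrier) → ∃ (IsSupremum a)

  IsPartition : ∀ {n} → (Fin n → Carrier) → Set (b ⊔ β)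
  IsPartition a = (∀ i j → i ≢ j → a i ∧ a j ≈ ⊥) × IsSupremum a ⊤

module _ {b β : Level} (B : BooleanAlgebra b β) where

  private module B = BooleanAlgebra B

  -- The fields of IsGeneralMetric other than symmetry, d x y ≈ ⊥ iff x ≈ y and
  -- the triangle inequality are automatic in a Boolean algebra.
  record BooleanMetricSpace (c e : Level) : Set (b ⊔ β ⊔ suc (c ⊔ e)) where
    infix 4 _≈_
    field
      Carrier  : Set c
      _≈_      : Rel Carrier e
      d        : Carrier → Carrier → B.Carrier
      isMetric : IsGeneralMetric _≈_ B._≈_ (Order B) B.⊥ B._∨_ d

    open IsGeneralMetric isMetric public

    setoid : Setoid c e
    setoid = record { isEquivalence = ≈-isEquivalence }

module _ {b β c e : Level} {B : BooleanAlgebra b β} (X : BooleanMetricSpace B c e) where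

  private module B = BooleanAlgebra B
  open BooleanMetricSpace X

  IsConvexCombination : ∀ {n} → Carrier → (Fin n → Carrier) → (Fin n → B.Carrier) → Set β
  IsConvexCombination z x a = ∀ i → a i B.∧ d z (x i) B.≈ B.⊥

  IsConvex : Set (b ⊔ β ⊔ c)
  IsConvex = ∀ (n : ℕ) (x : Fin (1+ n) → Carrier) (a : Fin (1+ n) → B.Carrier) →
    IsPartition B a → ∃ λ z → IsConvexCombination z x a

  -- Finite subsets are given by lists, with membership up to _≈_.
  IsFinitelyGenerated : Set (b ⊔ β ⊔ c ⊔ e)
  IsFinitelyGenerated = Σ (List Carrier) λ S → ∀ z →
    ∃ λ (n : ℕ) → Σ (Fin (1+ n) → Carrier) λ x → Σ (Fin (1+ n) → B.Carrier) λ a →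
      (∀ i → x i ∈ S) × IsPartition B a × IsConvexCombination z x a
    where open Membership setoid using (_∈_)

  IsCFG : Set (b ⊔ β ⊔ c ⊔ e)
  IsCFG = IsConvex × IsFinitelyGenerated

  record Subset (p : Level) : Set (c ⊔ e ⊔ suc p) where
    field
      member   : Pred Carrier p
      respects : member Respects _≈_

  open Subset

  subspace : ∀ {p} → Subset p → BooleanMetricSpace B (c ⊔ p) e
  subspace U = record
    { Carrier  = ∃ (member U)
    ; _≈_      = _≈_ on proj₁
    ; d        = d on proj₁
    ; isMetric = record
      { isSemiMetric = record
        { isQuasiSemiMetric = record
          { isPreMetric = record
            { isProtoMetric = record
              { isPartialOrder  = isPartialOrder
              ; ≈-isEquivalence = On.isEquivalence proj₁ ≈-isEquivalence
              ; cong            = cong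
              ; nonNegative     = nonNegative
              }
            ; ≈⇒0 = ≈⇒0
            }
          ; 0⇒≈ = 0⇒≈
          }
        ; sym = λ x y → sym (proj₁ x) (proj₁ y)
        }
      ; triangle = λ x y z → triangle (proj₁ x) (proj₁ y) (proj₁ z)
      }
    }

module _ {b β c e : Level} {B : BooleanAlgebra b β} (X : BooleanMetricSpace B c e) where

  open Subset

  -- The intersection of all CFG-subspaces containing U.  Quantifying over the
  -- subsets at level p places the intersection one universe higher.
  Conv : ∀ {p} → Subset X p → Subset X (b ⊔ β ⊔ c ⊔ e ⊔ suc p)
  Conv {p} U = record
    { member   = λ x → (Z : Subset X p) → member U ⊆ member Z → IsCFG (subspace X Z) → member Z x
    ; respects = λ x≈y x∈ Z U⊆Z cfg → respects Z x≈y (x∈ Z U⊆Z cfg)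
    }

  toConv : ∀ {p} (U : Subset X p) → ∃ (member U) → ∃ (member (Conv U))
  toConv U (x , x∈U) = x , λ Z U⊆Z cfg → U⊆Z x∈U

module _ {b β c e c′ e′ : Level} {B : BooleanAlgebra b β}
         (X : BooleanMetricSpace B c e) (Y : BooleanMetricSpace B c′ e′) where

  private
    module B = BooleanAlgebra B
    module X = BooleanMetricSpace X
    module Y = BooleanMetricSpace Y

  Map : Set (c ⊔ e ⊔ c′ ⊔ e′)
  Map = Func X.setoid Y.setoid

  open Func using (to)

  IsContractive : Map → Set (β ⊔ c)
  IsContractive f = ∀ x y → Order B (Y.d (to f x) (to f y)) (X.d x y)

  IsIsometry : Map → Set (β ⊔ c ⊔ e ⊔ c′ ⊔ e′)
  IsIsometry f = Bijective X._≈_ Y._≈_ (to f) × (∀ x y → Y.d (to f x) (to f y) B.≈ X.d x y)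

module _ {b β c e c′ e′ p : Level} {B : BooleanAlgebra b β}
         (X : BooleanMetricSpace B c e) (Y : BooleanMetricSpace B c′ e′)
         (U : Subset X p) (V : Subset Y p) where

  private module Y = BooleanMetricSpace Y
  open Func using (to)

  Extends : Map (subspace X (Conv X U)) (subspace Y (Conv Y V)) →
            Map (subspace X U) (subspace Y V) → Set (c ⊔ p ⊔ e′)
  Extends g f = ∀ u → proj₁ (to g (toConv X U u)) Y.≈ proj₁ (to f u)

-- Conv U is the set of points x with inf {d x u | u ∈ U} = 0: this set is a
-- CFG-subspace, and a CFG-subspace contains every point at distance zero from it.
-- In a CFG-space over a complete B, a family (y i) and weights (w i) with infimum
-- zero and d (y i) (y j) ≤ w i ∨ w j admit a point z with d z (y i) ≤ w i.
-- Applied to the points f u with the weights d x u, this gives Conv(f)(x), the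
-- only y with d y (f u) ≤ d x u for all u in U.

{-# OPTIONS --safe #-}
module Submission where

open import Defs
open import Level using (Level)
open import Algebra.Lattice.Bundles using (BooleanAlgebra)
import Algebra.Lattice.Properties.BooleanAlgebra as BooleanAlgebraProperties
open import Data.Empty using (⊥-elim)
open import Data.Fin.Base using (Fin; zero; suc)
open import Data.List.Base using ([]; _∷_; length; lookup; tabulate)
import Data.List.Membership.Setoid.Properties as Membership
open import Data.List.Relation.Unary.Any using (index)
open import Data.List.Relation.Unary.Any.Properties using (lookup-index)
open import Data.Nat.Base using (ℕ) renaming (suc to 1+_)
open import Data.Product.Base using (Σ; ∃; _×_; _,_; proj₁; proj₂)
open import Data.Vec.Functional using () renaming ([] to ⟨⟩; _∷_ to _◂_)
open import Function.Base using (_∘_)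
open import Function.Bundles using (Func)
open import Relation.Binary.Bundles using (Poset)
import Relation.Binary.Lattice.Bundles as OrderTheoretic
import Relation.Binary.Lattice.Properties.JoinSemilattice as JoinProperties
import Relation.Binary.Lattice.Properties.MeetSemilattice as MeetProperties
import Relation.Binary.Reasoning.PartialOrder as PosetReasoning
open import Relation.Binary.PropositionalEquality.Core using (_≢_; refl) renaming (cong to ≡-cong)

-- Order, vanishing families and partitions in a Boolean algebra.

module BooleanOrder {b β : Level} (B : BooleanAlgebra b β) where

  open BooleanAlgebra B public hiding (refl; sym; trans; reflexive)
  open BooleanAlgebra B using (sym)
  open BooleanAlgebraProperties B public
  open Poset poset public using (_≤_) renaming
    (refl to ≤-refl; trans to ≤-trans; antisym to ≤-antisym; reflexive to ≤-reflexive)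
  open OrderTheoretic.Lattice ∨-∧-orderTheoreticLattice public
    using (x≤x∨y; y≤x∨y; ∨-least; x∧y≤x; x∧y≤y; ∧-greatest)
  open JoinProperties (OrderTheoretic.Lattice.joinSemilattice ∨-∧-orderTheoreticLattice) public
    using (∨-monotonic)
  open MeetProperties (OrderTheoretic.Lattice.meetSemilattice ∨-∧-orderTheoreticLattice) public
    using (∧-monotonic)
  module ≤-Reasoning = PosetReasoning poset
  open ≤-Reasoning

  ⊥≤x : ∀ {x} → ⊥ ≤ x
  ⊥≤x = sym (∧-zeroˡ _)

  x≤⊤ : ∀ {x} → x ≤ ⊤
  x≤⊤ = sym (∧-identityʳ _)

  x≤⊥⇒x≈⊥ : ∀ {x} → x ≤ ⊥ → x ≈ ⊥
  x≤⊥⇒x≈⊥ x≤⊥ = ≤-antisym x≤⊥ ⊥≤x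

  x∧¬y≤z⇒x≤y∨z : ∀ {x y z} → x ∧ ¬ y ≤ z → x ≤ y ∨ z
  x∧¬y≤z⇒x≤y∨z {x} {y} {z} h = begin
    x                ≈⟨ ∧-identityʳ x ⟨
    x ∧ ⊤            ≈⟨ ∧-congˡ (∨-complementʳ y) ⟨
    x ∧ (y ∨ ¬ y)    ≈⟨ ∧-distribˡ-∨ x y (¬ y) ⟩
    x ∧ y ∨ x ∧ ¬ y  ≤⟨ ∨-monotonic (x∧y≤y x y) h ⟩
    y ∨ z            ∎

  x≤y∨z⇒x∧¬y≤z : ∀ {x y z} → x ≤ y ∨ z → x ∧ ¬ y ≤ z
  x≤y∨z⇒x∧¬y≤z {x} {y} {z} h = begin
    x ∧ ¬ y            ≤⟨ ∧-monotonic h ≤-refl ⟩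
    (y ∨ z) ∧ ¬ y      ≈⟨ ∧-distribʳ-∨ (¬ y) y z ⟩
    y ∧ ¬ y ∨ z ∧ ¬ y  ≤⟨ ∨-monotonic (≤-reflexive (∧-complementʳ y)) (x∧y≤x z (¬ y)) ⟩
    ⊥ ∨ z              ≈⟨ ∨-identityˡ z ⟩
    z                  ∎

  x∧y≤z⇒x≤¬y∨z : ∀ {x y z} → x ∧ y ≤ z → x ≤ ¬ y ∨ z
  x∧y≤z⇒x≤¬y∨z {x} {y} h =
    x∧¬y≤z⇒x≤y∨z (≤-trans (≤-reflexive (∧-congˡ (¬-involutive y))) h)

  x≤¬y∨z⇒x∧y≤z : ∀ {x y z} → x ≤ ¬ y ∨ z → x ∧ y ≤ z
  x≤¬y∨z⇒x∧y≤z {x} {y} h =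
    ≤-trans (≤-reflexive (∧-congˡ (sym (¬-involutive y)))) (x≤y∨z⇒x∧¬y≤z h)

  x≤¬y⇒x∧y≤⊥ : ∀ {x y} → x ≤ ¬ y → x ∧ y ≤ ⊥
  x≤¬y⇒x∧y≤⊥ {x} {y} h =
    ≤-trans (∧-monotonic h ≤-refl) (≤-reflexive (∧-complementˡ y))

  ∨-swap-≤ : ∀ {x y z} → x ≤ y ∨ z → x ≤ z ∨ y
  ∨-swap-≤ {x} {y} {z} h = ≤-trans h (≤-reflexive (∨-comm y z))

  -- The infimum of `w` is `⊥`, phrased through lower bounds so that it makes sense over an
  -- incomplete `B` too.
  Vanishes : ∀ {i} {I : Set i} → (I → Carrier) → Set _
  Vanishes w = ∀ r → (∀ i → r ≤ w i) → r ≤ ⊥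

  -- The element `r ∧ ¬ q` is a lower bound of `w`. This is the limit argument used throughout: an
  -- error term that vanishes over `i` may be dropped.
  vanishes-∨ : ∀ {i} {I : Set i} {w : I → Carrier} → Vanishes w →
               ∀ {q r} → (∀ i → r ≤ q ∨ w i) → r ≤ q
  vanishes-∨ w↓⊥ {q} h = ≤-trans
    (x∧¬y≤z⇒x≤y∨z (w↓⊥ _ (x≤y∨z⇒x∧¬y≤z ∘ h)))
    (≤-reflexive (∨-identityʳ q))

  -- An inequality may be checked piece by piece: `¬ r ∨ q` bounds every `a i`, hence also `⊤`.
  partition-≤ : ∀ {n} {a : Fin n → Carrier} → IsPartition B a →
                ∀ {q r} → (∀ i → a i ∧ r ≤ q) → r ≤ q
  partition-≤ (_ , _ , least) {q} {r} h = begin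
    r      ≈⟨ ∧-identityˡ r ⟨
    ⊤ ∧ r  ≤⟨ x≤¬y∨z⇒x∧y≤z (least _ (x∧y≤z⇒x≤¬y∨z ∘ h)) ⟩
    q      ∎

  disjointify : ∀ {n} → (Fin n → Carrier) → Fin n → Carrier
  disjointify a zero    = a zero
  disjointify a (suc i) = ¬ a zero ∧ disjointify (a ∘ suc) i

  disjointify-≤ : ∀ {n} (a : Fin n → Carrier) i → disjointify a i ≤ a i
  disjointify-≤ a zero    = ≤-refl
  disjointify-≤ a (suc i) = ≤-trans (x∧y≤y _ _) (disjointify-≤ (a ∘ suc) i)

  disjointify-disjoint : ∀ {n} (a : Fin n → Carrier) i j → i ≢ j →
                         disjointify a i ∧ disjointify a j ≤ ⊥
  disjointify-disjoint a zero    zero    i≢j = ⊥-elim (i≢j refl)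
  disjointify-disjoint a zero    (suc j) i≢j = begin
    a zero ∧ (¬ a zero ∧ _)  ≤⟨ ∧-monotonic ≤-refl (x∧y≤x _ _) ⟩
    a zero ∧ ¬ a zero        ≈⟨ ∧-complementʳ _ ⟩
    ⊥                        ∎
  disjointify-disjoint a (suc i) zero    i≢j = begin
    (¬ a zero ∧ _) ∧ a zero  ≤⟨ ∧-monotonic (x∧y≤x _ _) ≤-refl ⟩
    ¬ a zero ∧ a zero        ≈⟨ ∧-complementˡ _ ⟩
    ⊥                        ∎
  disjointify-disjoint a (suc i) (suc j) i≢j = ≤-trans
    (∧-monotonic (x∧y≤y _ _) (x∧y≤y _ _))
    (disjointify-disjoint (a ∘ suc) i j (i≢j ∘ ≡-cong suc))

  -- Disjointification keeps the supremum. In the induction the bound for the tail grows to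
  -- `a zero ∨ t`, which `h zero` brings back below `t`.
  disjointify-bound : ∀ {n} (a : Fin n → Carrier) {t} →
                      (∀ i → disjointify a i ≤ t) → ∀ i → a i ≤ t
  disjointify-bound a h zero    = h zero
  disjointify-bound a {t} h (suc i) = begin
    a (suc i)   ≤⟨ disjointify-bound (a ∘ suc) tail≤ i ⟩
    a zero ∨ t  ≤⟨ ∨-least (h zero) ≤-refl ⟩
    t           ∎
    where
    tail≤ : ∀ j → disjointify (a ∘ suc) j ≤ a zero ∨ t
    tail≤ j = x∧¬y≤z⇒x≤y∨z (≤-trans (≤-reflexive (∧-comm _ _)) (h (suc j)))

  vanishes⇒partition : ∀ {n} {w : Fin n → Carrier} → Vanishes w →
                       IsPartition B (disjointify (¬_ ∘ w))
  vanishes⇒partition {w = w} w↓⊥ =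
    (λ i j i≢j → x≤⊥⇒x≈⊥ (disjointify-disjoint (¬_ ∘ w) i j i≢j)) ,
    (λ _ → x≤⊤) ,
    -- If `t` bounds every `¬ w i`, then `⊤ ≤ t ∨ w i` for all `i`, and the `w i` drop out.
    (λ t h → vanishes-∨ w↓⊥ (λ i → ∨-swap-≤ (x∧¬y≤z⇒x≤y∨z
      (≤-trans (x∧y≤y _ _) (disjointify-bound (¬_ ∘ w) h i)))))

module _ {ℓ : Level} (B : BooleanAlgebra ℓ ℓ) (complete : IsComplete B ℓ) where

  open BooleanOrder B

  -- The supremum of all lower bounds. These form a type in `Set ℓ` because `B` has both its levels
  -- equal to `ℓ`.
  infimum : {I : Set ℓ} (w : I → Carrier) →
            Σ Carrier λ m → (∀ i → m ≤ w i) × (∀ r → (∀ i → r ≤ w i) → r ≤ m)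
  infimum w with complete {I = Σ Carrier λ r → ∀ i → r ≤ w i} proj₁
  ... | m , upper , least =
    m , (λ i → least (w i) (λ r → proj₂ r i)) , (λ r r≤w → upper (r , r≤w))

-- Adherence, finite nets and gluing in Boolean metric spaces.

module _ {b β c e : Level} {B : BooleanAlgebra b β} (X : BooleanMetricSpace B c e) where

  open BooleanOrder B hiding (_≈_; setoid) renaming (Carrier to 𝔹)
  open BooleanMetricSpace X using (Carrier; setoid; d)
  private
    module X = BooleanMetricSpace X
  open ≤-Reasoning

  d-sym : ∀ {x y} → d x y ≤ d y x
  d-sym = ≤-reflexive (X.sym _ _)

  d-triangleʳ : ∀ {x} y {z} → d x z ≤ d x y ∨ d z y
  d-triangleʳ y = ≤-trans (X.triangle _ y _) (∨-monotonic ≤-refl d-sym)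

  d-triangleˡ : ∀ {x} y {z} → d x z ≤ d y x ∨ d y z
  d-triangleˡ y = ≤-trans (X.triangle _ y _) (∨-monotonic d-sym ≤-refl)

  -- Distance zero from the family, which is weaker than being one of its points: different pieces
  -- of `B` may call for different members.
  Adherent : ∀ {i} {I : Set i} → (I → Carrier) → Carrier → Set _
  Adherent s x = Vanishes (λ i → d x (s i))

  adherent-trans : ∀ {i j} {I : Set i} {J : Set j} {s : I → Carrier} {t : J → Carrier} {x} →
                   Adherent s x → (∀ i → Adherent t (s i)) → Adherent t x
  adherent-trans x∈s s⊆t r r≤ =
    x∈s r (λ i → vanishes-∨ (s⊆t i) (λ j → ≤-trans (r≤ j) (X.triangle _ _ _)))

  -- On the piece `a i` the point `z` coincides with `x i`, so a common lower bound of the distances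
  -- is `⊥` on every piece.
  combination⇒adherent : ∀ {n} {x : Fin n → Carrier} {a z} → IsPartition B a →
                         IsConvexCombination X z x a → Adherent x z
  combination⇒adherent a-part comb r r≤ = partition-≤ a-part
    (λ i → ≤-trans (∧-monotonic ≤-refl (r≤ i)) (≤-reflexive (comb i)))

  HasFiniteNet : Set _
  HasFiniteNet = Σ ℕ λ n → Σ (Fin (1+ n) → Carrier) λ s → ∀ x → Adherent s x

  finitelyGenerated⇒net : IsFinitelyGenerated X → Carrier → HasFiniteNet
  -- The combination giving `x₀` has at least one term, so the generating list cannot be empty.
  finitelyGenerated⇒net ([] , gen) x₀ with gen x₀
  ... | _ , _ , _ , x∈S , _ with x∈S zero
  ...   | ()
  finitelyGenerated⇒net (S@(y ∷ ys) , gen) _ = length ys , lookup S , adherent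
    where
    adherent : ∀ z → Adherent (lookup S) z
    adherent z r r≤ with gen z
    ... | _ , x , _ , x∈S , a-part , comb = combination⇒adherent a-part comb r
      (λ i → ≤-trans (r≤ (index (x∈S i)))
        (≤-reflexive (X.cong X.EqC.refl (X.EqC.sym (lookup-index (x∈S i))))))

  -- Coefficients for `z` come from disjointifying the elements `¬ d z (s i)`, on which `z` and
  -- `s i` coincide.
  net⇒finitelyGenerated : HasFiniteNet → IsFinitelyGenerated X
  net⇒finitelyGenerated (n , s , adherent) = tabulate s , λ z →
    n , s , disjointify (λ i → ¬ d z (s i)) ,
    Membership.∈-tabulate⁺ setoid ,
    vanishes⇒partition (adherent z) ,
    λ i → x≤⊥⇒x≈⊥ (x≤¬y⇒x∧y≤⊥ (disjointify-≤ (λ j → ¬ d z (s j)) i))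

  -- Glue the `s j` along pieces `a j ≤ ¬ w j`. On `a j` the glued point is `s j`, and outside `w j`
  -- compatibility leaves `d (s j) (s i) ≤ w i`.
  realise-finite : IsConvex X → ∀ {n} (s : Fin (1+ n) → Carrier) (w : Fin (1+ n) → 𝔹) →
                   Vanishes w → (∀ i j → d (s i) (s j) ≤ w i ∨ w j) →
                   ∃ λ z → ∀ i → d z (s i) ≤ w i
  realise-finite convex s w w↓⊥ compat
    with convex _ s _ (vanishes⇒partition w↓⊥)
  ... | z , comb = z , λ i → partition-≤ (vanishes⇒partition w↓⊥) (λ j → begin
    a j ∧ d z (s i)                        ≤⟨ ∧-monotonic ≤-refl (X.triangle _ (s j) _) ⟩
    a j ∧ (d z (s j) ∨ d (s j) (s i))      ≈⟨ ∧-distribˡ-∨ _ _ _ ⟩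
    a j ∧ d z (s j) ∨ a j ∧ d (s j) (s i)  ≤⟨ ∨-least (≤-trans (≤-reflexive (comb j)) ⊥≤x) (begin
      a j ∧ d (s j) (s i)                     ≤⟨ ∧-monotonic (disjointify-≤ (¬_ ∘ w) j) (compat j i) ⟩
      ¬ w j ∧ (w j ∨ w i)                     ≈⟨ ∧-comm _ _ ⟩
      (w j ∨ w i) ∧ ¬ w j                     ≤⟨ x≤y∨z⇒x∧¬y≤z ≤-refl ⟩
      w i                                     ∎) ⟩
    w i                                    ∎)
    where a = disjointify (¬_ ∘ w)

-- Realising arbitrary compatible weights in a CFG-space.

module _ {ℓ : Level} {B : BooleanAlgebra ℓ ℓ} (complete : IsComplete B ℓ)
         (X : BooleanMetricSpace B ℓ ℓ) (X-cfg : IsCFG X) where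

  open BooleanOrder B hiding (_≈_; setoid) renaming (Carrier to 𝔹)
  open BooleanMetricSpace X using (Carrier; d; cong; ≈⇒0; 0⇒≈; triangle; module EqC)
  open Subset
  open ≤-Reasoning

  -- It suffices to realise on a finite net s the weights inf {w i ∨ d (y i) (s k) | i},
  -- the upper bounds on d z (s k) that the required bounds on d z (y i) imply.
  realise : {I : Set ℓ} (y : I → Carrier) (w : I → 𝔹) → Carrier →
            Vanishes w → (∀ i j → d (y i) (y j) ≤ w i ∨ w j) →
            ∃ λ z → ∀ i → d z (y i) ≤ w i
  realise {I} y w x₀ w↓⊥ compat with finitelyGenerated⇒net X (proj₂ X-cfg) x₀
  ... | n , s , adherent = proj₁ point , z-near
    where
    inf : ∀ k → _
    inf k = infimum B complete (λ i → w i ∨ d (y i) (s k))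

    v : Fin (1+ n) → 𝔹
    v k = proj₁ (inf k)

    v≤ : ∀ k i → v k ≤ w i ∨ d (y i) (s k)
    v≤ k = proj₁ (proj₂ (inf k))

    ≤v : ∀ {q r} k → (∀ i → r ≤ q ∨ (w i ∨ d (y i) (s k))) → r ≤ q ∨ v k
    ≤v k h = x∧¬y≤z⇒x≤y∨z (proj₂ (proj₂ (inf k)) _ (x≤y∨z⇒x∧¬y≤z ∘ h))

    -- Two limits: the net removes `d (y i) (s k)` over `k`, then `w` vanishes over `i`.
    v↓⊥ : Vanishes v
    v↓⊥ r r≤v = w↓⊥ r λ i → vanishes-∨ (adherent (y i)) (λ k → ≤-trans (r≤v k) (v≤ k i))

    v-compat : ∀ k l → d (s k) (s l) ≤ v k ∨ v l
    -- The two infima are opened one at a time, `v l` over `j` and `v k` over `i`, and the path runs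
    -- from `s k` through `y i` and `y j` to `s l`.
    v-compat k l = ≤v l λ j → ∨-swap-≤ (≤v k λ i → begin
      d (s k) (s l)
        ≤⟨ d-triangleˡ X (y i) ⟩
      d (y i) (s k) ∨ d (y i) (s l)
        ≤⟨ ∨-monotonic ≤-refl (triangle _ (y j) _) ⟩
      d (y i) (s k) ∨ (d (y i) (y j) ∨ d (y j) (s l))
        ≤⟨ ∨-monotonic ≤-refl (∨-monotonic (compat i j) ≤-refl) ⟩
      d (y i) (s k) ∨ ((w i ∨ w j) ∨ d (y j) (s l))
        ≤⟨ ∨-least
             (≤-trans (y≤x∨y _ _) (y≤x∨y _ _))
             (∨-least
               (∨-least (≤-trans (x≤x∨y _ _) (y≤x∨y _ _)) (≤-trans (x≤x∨y _ _) (x≤x∨y _ _)))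
               (≤-trans (y≤x∨y _ _) (x≤x∨y _ _))) ⟩
      (w j ∨ d (y j) (s l)) ∨ (w i ∨ d (y i) (s k)) ∎)

    point : ∃ λ z → ∀ k → d z (s k) ≤ v k
    point = realise-finite X (proj₁ X-cfg) s v v↓⊥ v-compat

    z-near : ∀ i → d (proj₁ point) (y i) ≤ w i
    z-near i = vanishes-∨ (adherent (y i)) λ k → begin
      d (proj₁ point) (y i)                 ≤⟨ d-triangleʳ X (s k) ⟩
      d (proj₁ point) (s k) ∨ d (y i) (s k) ≤⟨ ∨-monotonic (≤-trans (proj₂ point k) (v≤ k i)) ≤-refl ⟩
      (w i ∨ d (y i) (s k)) ∨ d (y i) (s k) ≤⟨ ∨-least ≤-refl (y≤x∨y _ _) ⟩
      w i ∨ d (y i) (s k)                   ∎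

  -- The closure of a nonempty subset is its `Conv`.

  module _ (U : Subset X ℓ) where

    -- Stays at level `ℓ`, one below `Conv X U`, so it is itself among the subsets that `Conv`
    -- intersects.
    closure : Subset X ℓ
    closure = record
      { member   = Adherent X {I = ∃ (member U)} proj₁
      ; respects = λ x≈y x∈ r r≤ →
          x∈ r (λ u → ≤-trans (r≤ u) (≤-reflexive (cong (EqC.sym x≈y) EqC.refl)))
      }

    U⊆closure : ∀ {x} → member U x → member closure x
    U⊆closure {x} x∈U r r≤ = ≤-trans (r≤ (x , x∈U)) (≤-reflexive (≈⇒0 EqC.refl))

    closure-convex : IsConvex (subspace X closure)
    closure-convex n x a a-part with proj₁ X-cfg n (proj₁ ∘ x) a a-part
    ... | z , comb =
      (z , adherent-trans X (combination⇒adherent X a-part comb) (proj₂ ∘ x)) , comb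

    module _ (u₀ : ∃ (member U)) where

      -- A nearest point of the closure to s: with m = inf {d s u | u ∈ U}, it agrees
      -- with s off m and with u₀ on m.
      project : ∀ s → Σ (∃ (member closure)) λ p → ∀ {x} → member closure x →
                d x (proj₁ p) ≤ d x s
      project s with infimum B complete (λ (u : ∃ (member U)) → d s (proj₁ u))
      ... | m , m≤ , ≤m = (p , p-adherent) , λ {x} x∈ → begin
            d x p         ≤⟨ d-triangleʳ X s ⟩
            -- Here `d p s ≤ m`, and `m ≤ d s u ≤ d x s ∨ d x u` for all `u`, where `d x u` vanishes
            -- over `U`.
            d x s ∨ d p s ≤⟨ ∨-least ≤-refl (≤-trans (near zero) (vanishes-∨ x∈ λ u →
                               ≤-trans (m≤ u) (d-triangleˡ X x))) ⟩
            d x s         ∎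
        where
        w : Fin 2 → 𝔹
        w = m ◂ (¬ m) ◂ ⟨⟩

        pts : Fin 2 → Carrier
        pts = s ◂ proj₁ u₀ ◂ ⟨⟩

        w↓⊥ : Vanishes w
        w↓⊥ r r≤ = ≤-trans (∧-greatest (r≤ zero) (r≤ (suc zero))) (≤-reflexive (∧-complementʳ m))

        w-compat : ∀ i j → d (pts i) (pts j) ≤ w i ∨ w j
        w-compat zero       zero       = ≤-trans (≤-reflexive (≈⇒0 EqC.refl)) ⊥≤x
        w-compat zero       (suc zero) = ≤-trans x≤⊤ (≤-reflexive (BooleanAlgebra.sym B (∨-complementʳ m)))
        w-compat (suc zero) zero       = ≤-trans x≤⊤ (≤-reflexive (BooleanAlgebra.sym B (∨-complementˡ m)))
        w-compat (suc zero) (suc zero) = ≤-trans (≤-reflexive (≈⇒0 EqC.refl)) ⊥≤x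

        glued : ∃ λ z → ∀ i → d z (pts i) ≤ w i
        glued = realise-finite X (proj₁ X-cfg) pts w w↓⊥ w-compat

        p : Carrier
        p = proj₁ glued

        near : ∀ i → d p (pts i) ≤ w i
        near = proj₂ glued

        p-adherent : member closure p
        p-adherent r r≤ = w↓⊥ r r≤w
          where
          -- A lower bound of the distances from `p` to `U` lies below `m` through `s` and below
          -- `¬ m` through `u₀`.
          r≤w : ∀ i → r ≤ w i
          r≤w zero       = ≤m r λ u → begin
            r                        ≤⟨ r≤ u ⟩
            d p (proj₁ u)            ≤⟨ triangle _ s _ ⟩
            d p s ∨ d s (proj₁ u)    ≤⟨ ∨-least (≤-trans (near zero) (m≤ u)) ≤-refl ⟩
            d s (proj₁ u)            ∎
          r≤w (suc zero) = ≤-trans (r≤ u₀) (near (suc zero))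

      -- Projecting a finite net of `X` gives a net of the closure, since projection brings no point
      -- of the closure farther away.
      closure-cfg : IsCFG (subspace X closure)
      closure-cfg with finitelyGenerated⇒net X (proj₂ X-cfg) (proj₁ u₀)
      ... | n , s , adherent = closure-convex ,
        net⇒finitelyGenerated (subspace X closure)
          (n , (λ i → proj₁ (project (s i))) ,
           λ (x , x∈) r r≤ → adherent x r (λ i → ≤-trans (r≤ i) (proj₂ (project (s i)) x∈)))

      Conv⊆closure : ∀ {x} → member (Conv X U) x → member closure x
      Conv⊆closure x∈ = x∈ closure U⊆closure closure-cfg

      -- Realising inside `Z` the distances from `x` to a finite net of `Z` yields a point of `Z` at
      -- distance zero from `x`.
      closure⊆Conv : ∀ {x} → member closure x → member (Conv X U) x
      closure⊆Conv {x} x∈ Z U⊆Z (Z-convex , Z-fg)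
        with finitelyGenerated⇒net (subspace X Z) Z-fg (proj₁ u₀ , U⊆Z (proj₂ u₀))
      ... | n , s , adherent = respects Z (EqC.sym x≈z) (proj₂ z)
        where
        x-adherent : Adherent X (proj₁ ∘ s) x
        x-adherent = adherent-trans X x∈ (λ u → adherent (proj₁ u , U⊆Z (proj₂ u)))

        point : ∃ λ z → ∀ i → d (proj₁ z) (proj₁ (s i)) ≤ d x (proj₁ (s i))
        point = realise-finite (subspace X Z) Z-convex s (λ i → d x (proj₁ (s i)))
          x-adherent (λ i j → d-triangleˡ X x)

        z : ∃ (member Z)
        z = proj₁ point

        x≈z : BooleanMetricSpace._≈_ X x (proj₁ z)
        x≈z = 0⇒≈ (x≤⊥⇒x≈⊥ (x-adherent _ λ i → begin
          d x (proj₁ z)                                 ≤⟨ d-triangleʳ X (proj₁ (s i)) ⟩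
          d x (proj₁ (s i)) ∨ d (proj₁ z) (proj₁ (s i)) ≤⟨ ∨-least ≤-refl (proj₂ point i) ⟩
          d x (proj₁ (s i))                             ∎))

-- Extension of contractive maps and isometries.

module _ {b β c e c′ e′ : Level} {B : BooleanAlgebra b β}
         (X : BooleanMetricSpace B c e) (Y : BooleanMetricSpace B c′ e′) where

  open BooleanOrder B hiding (_≈_; setoid; Carrier)
  private
    module X = BooleanMetricSpace X
    module Y = BooleanMetricSpace Y
  open ≤-Reasoning

  -- Passing through `v i` costs `d x (u i)`, which vanishes. This yields contractivity, uniqueness
  -- and, with the spaces exchanged, expansiveness.
  limits-contract : ∀ {i} {I : Set i} {u : I → X.Carrier} {v : I → Y.Carrier} {x x′ y y′} →
    Adherent X u x →
    (∀ i → Y.d y (v i) ≤ X.d x (u i)) → (∀ i → Y.d y′ (v i) ≤ X.d x′ (u i)) →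
    Y.d y y′ ≤ X.d x x′
  limits-contract {u = u} {v} {x} {x′} {y} {y′} x∈ y≤x y′≤x′ = vanishes-∨ x∈ λ i → begin
    Y.d y y′                           ≤⟨ d-triangleʳ Y (v i) ⟩
    Y.d y (v i) ∨ Y.d y′ (v i)         ≤⟨ ∨-monotonic (y≤x i) (y′≤x′ i) ⟩
    X.d x (u i) ∨ X.d x′ (u i)         ≤⟨ ∨-least (y≤x∨y _ _) (d-triangleˡ X x) ⟩
    X.d x x′ ∨ X.d x (u i)             ∎

theorem4p3 : {ℓ : Level} (B : BooleanAlgebra ℓ ℓ) → IsComplete B ℓ →
    (X Y : BooleanMetricSpace B ℓ ℓ) → IsCFG X → IsCFG Y →
    (U : Subset X ℓ) (V : Subset Y ℓ) →
    ∃ (Subset.member U) → ∃ (Subset.member V) →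
    (f : Map (subspace X U) (subspace Y V)) →
    IsContractive (subspace X U) (subspace Y V) f →
    let ConvU = subspace X (Conv X U)
        ConvV = subspace Y (Conv Y V)
    in Σ (Map ConvU ConvV) λ Conv-f →
         (IsContractive ConvU ConvV Conv-f × Extends X Y U V Conv-f f) ×
         ((g : Map ConvU ConvV) → IsContractive ConvU ConvV g → Extends X Y U V g f →
           ∀ x → BooleanMetricSpace._≈_ ConvV (Func.to g x) (Func.to Conv-f x)) ×
         (IsIsometry (subspace X U) (subspace Y V) f → IsIsometry ConvU ConvV Conv-f)
theorem4p3 {ℓ} B complete X Y X-cfg Y-cfg U V u₀ v₀ f f-contr =
  Conv-f , (contractive , extends) , unique , isometry
  where
  open BooleanOrder B hiding (_≈_; setoid; Carrier)
  module X = BooleanMetricSpace X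
  module Y = BooleanMetricSpace Y
  open Subset
  open Func using (to)
  open ≤-Reasoning

  ConvU = subspace X (Conv X U)
  ConvV = subspace Y (Conv Y V)

  f₁ : ∃ (member U) → Y.Carrier
  f₁ u = proj₁ (to f u)

  _∼_ : X.Carrier → Y.Carrier → Set ℓ
  x ∼ y = ∀ u → Y.d y (f₁ u) ≤ X.d x (proj₁ u)

  adherentX : (x : ∃ (member (Conv X U))) → Adherent X {I = ∃ (member U)} proj₁ (proj₁ x)
  adherentX x = Conv⊆closure complete X X-cfg U u₀ (proj₂ x)

  image : (x : ∃ (member (Conv X U))) → ∃ λ y → proj₁ x ∼ y
  image (x , x∈) = realise complete Y Y-cfg f₁ (λ u → X.d x (proj₁ u)) (proj₁ v₀)
    (adherentX (x , x∈)) (λ u u′ → ≤-trans (f-contr u u′) (d-triangleˡ X x))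

  image-adherent : ∀ x → Adherent Y f₁ (proj₁ (image x))
  image-adherent x r r≤ = adherentX x r (λ u → ≤-trans (r≤ u) (proj₂ (image x) u))

  image-contractive : ∀ x x′ → Y.d (proj₁ (image x)) (proj₁ (image x′)) ≤ X.d (proj₁ x) (proj₁ x′)
  image-contractive x x′ = limits-contract X Y (adherentX x) (proj₂ (image x)) (proj₂ (image x′))

  followers-agree : ∀ (x : ∃ (member (Conv X U))) {y y′} → proj₁ x ∼ y → proj₁ x ∼ y′ → y Y.≈ y′
  followers-agree x x∼y x∼y′ = Y.0⇒≈ (x≤⊥⇒x≈⊥ (≤-trans
    (limits-contract X Y (adherentX x) x∼y x∼y′) (≤-reflexive (X.≈⇒0 X.EqC.refl))))

  Conv-f : Map ConvU ConvV
  Conv-f = record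
    { to   = λ x → proj₁ (image x) , closure⊆Conv complete Y Y-cfg V v₀
               (λ r r≤ → image-adherent x r (λ u → r≤ (to f u)))
    ; cong = λ {x} {x′} x≈x′ → Y.0⇒≈ (x≤⊥⇒x≈⊥
               (≤-trans (image-contractive x x′) (≤-reflexive (X.≈⇒0 x≈x′))))
    }

  contractive : IsContractive ConvU ConvV Conv-f
  contractive = image-contractive

  extends : Extends X Y U V Conv-f f
  -- Contractivity of `f` says precisely that `f u` satisfies the inequalities that determine the
  -- image of `u`.
  extends u = followers-agree (toConv X U u) (proj₂ (image (toConv X U u))) (f-contr u)

  unique : (g : Map ConvU ConvV) → IsContractive ConvU ConvV g → Extends X Y U V g f →
           ∀ x → proj₁ (to g x) Y.≈ proj₁ (to Conv-f x)
  unique g g-contr g-ext x = followers-agree x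
    (λ u → ≤-trans (≤-reflexive (Y.cong Y.EqC.refl (Y.EqC.sym (g-ext u)))) (g-contr x (toConv X U u)))
    (proj₂ (image x))

  isometry : IsIsometry (subspace X U) (subspace Y V) f → IsIsometry ConvU ConvV Conv-f
  isometry ((_ , f-surj) , f-iso) =
    ((λ {x} {x′} fx≈fx′ → X.0⇒≈ (x≤⊥⇒x≈⊥
        (≤-trans (image-expansive x x′) (≤-reflexive (Y.≈⇒0 fx≈fx′))))) ,
     surjective) ,
    (λ x x′ → ≤-antisym (image-contractive x x′) (image-expansive x x′))
    where
    -- Detour through `u′`: the isometry moves `d u′ u` into `Y`, and every term involving `u′` is
    -- at most `d x u′`, which vanishes.
    follows-back : ∀ x u → X.d (proj₁ x) (proj₁ u) ≤ Y.d (proj₁ (image x)) (f₁ u)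
    follows-back x u = vanishes-∨ (adherentX x) λ u′ → begin
      X.d (proj₁ x) (proj₁ u)
        ≤⟨ X.triangle _ (proj₁ u′) _ ⟩
      X.d (proj₁ x) (proj₁ u′) ∨ X.d (proj₁ u′) (proj₁ u)
        ≈⟨ ∨-congˡ (f-iso u′ u) ⟨
      X.d (proj₁ x) (proj₁ u′) ∨ Y.d (f₁ u′) (f₁ u)
        ≤⟨ ∨-monotonic ≤-refl (d-triangleˡ Y (proj₁ (image x))) ⟩
      X.d (proj₁ x) (proj₁ u′) ∨ (Y.d (proj₁ (image x)) (f₁ u′) ∨ Y.d (proj₁ (image x)) (f₁ u))
        ≤⟨ ∨-least (y≤x∨y _ _)
             (∨-least (≤-trans (proj₂ (image x) u′) (y≤x∨y _ _)) (x≤x∨y _ _)) ⟩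
      Y.d (proj₁ (image x)) (f₁ u) ∨ X.d (proj₁ x) (proj₁ u′) ∎

    image-expansive : ∀ x x′ → X.d (proj₁ x) (proj₁ x′) ≤ Y.d (proj₁ (image x)) (proj₁ (image x′))
    image-expansive x x′ =
      limits-contract Y X (image-adherent x) (follows-back x) (follows-back x′)

    surjective : ∀ y → ∃ λ x → ∀ {z} → proj₁ z X.≈ proj₁ x →
                 proj₁ (to Conv-f z) Y.≈ proj₁ y
    surjective (y , y∈) = x , λ {z} z≈x →
      Y.EqC.trans (Func.cong Conv-f {z} {x} z≈x) (Y.0⇒≈ (x≤⊥⇒x≈⊥ (≤-trans
        -- Both the image of `x` and `y` itself are as close to each `f u` as `y` is, so they
        -- coincide.
        (limits-contract Y Y y-adherent
          (λ u → ≤-trans (proj₂ (image x) u) (proj₂ preimage u)) (λ u → ≤-refl))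
        (≤-reflexive (Y.≈⇒0 Y.EqC.refl)))))
      where
      -- By surjectivity of `f`, adherence to `V` is adherence to the values of `f`.
      y-adherent : Adherent Y f₁ y
      y-adherent = adherent-trans Y (Conv⊆closure complete Y Y-cfg V v₀ y∈)
        (λ v r r≤ → ≤-trans (r≤ (proj₁ (f-surj v)))
          (≤-reflexive (Y.≈⇒0 (Y.EqC.sym (proj₂ (f-surj v) X.EqC.refl)))))

      -- The construction of `image` run backwards; preservation of distances by `f` makes the
      -- weights compatible.
      preimage : ∃ λ x → ∀ u → X.d x (proj₁ u) ≤ Y.d y (f₁ u)
      preimage = realise complete X X-cfg proj₁ (λ u → Y.d y (f₁ u)) (proj₁ u₀) y-adherent
        (λ u u′ → ≤-trans (≤-reflexive (BooleanAlgebra.sym B (f-iso u u′))) (d-triangleˡ Y y))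

      x : ∃ (member (Conv X U))
      x = proj₁ preimage , closure⊆Conv complete X X-cfg U u₀
        (λ r r≤ → y-adherent r (λ u → ≤-trans (r≤ u) (proj₂ preimage u)))
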